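{- There is a function $b:\mathbb{N}\to\mathbb{N}$ such that $\pi_l(T)\leq b(k)$ for every tree $T$ of pathwidth $k$.
   Context: A vertex coloring $\phi$ of a graph $G$ is nonrepetitive if there is no path (with no repeated vertices) $u_1u_2\ldots u_{2r}$, $r\geq 1$, in $G$ with $\phi(u_i)=\phi(u_{r+i})$ for all $i\in\{1,\dots,r\}$. Given lists $L_v$ ($v\in V(G)$) of colors, a coloring with these lists is a coloring $\phi$ with $\phi(v)\in L_v$ for all $v$. The Thue choice number $\pi_l(G)$ is the minimum $\ell$ such that for every assignment of lists $L_v$ with $|L_v|\geq \ell$ for all $v\in V(G)$ there is a nonrepetitive coloring of $G$ with these lists. Pathwidth is the usual graph parameter. -}

module Defs where

open import Data.Nat using (ℕ; zero; suc; _+_; _≤_; _≥_; _<_)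
open import Data.Fin using (Fin; toℕ; _↑ˡ_; _↑ʳ_)
open import Data.Fin.Subset using (Subset; _∈_; ∣_∣)
open import Data.Bool using (Bool; T)
open import Data.List using (List; length)
open import Data.List.Relation.Unary.Unique.Propositional using (Unique)
import Data.List.Membership.Propositional as LM
open import Data.Product using (Σ; ∃; ∃-syntax; _×_)
open import Relation.Binary.PropositionalEquality using (_≡_)
open import Relation.Nullary using (¬_)
open import Function.Definitions using (Injective)

record Graph (n : ℕ) : Set where
  field
    adj   : Fin n → Fin n → Bool
    sym   : ∀ u v → T (adj u v) → T (adj v u)
    irrefl : ∀ v → ¬ T (adj v v)

open Graph public

Adj : ∀ {n} → Graph n → Fin n → Fin n → Set
Adj G u v = T (adj G u v)

IsPath : ∀ {n m} → Graph n → (Fin m → Fin n) → Set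
IsPath G p = Injective _≡_ _≡_ p
           × (∀ i j → suc (toℕ i) ≡ toℕ j → Adj G (p i) (p j))

Connected : ∀ {n} → Graph n → Set
Connected {n} G = ∀ (u v : Fin n) →
  ∃[ m ] Σ (Fin (suc m) → Fin n) λ p →
    IsPath G p × Σ (Fin (suc m)) λ j → toℕ j ≡ m × p Data.Fin.zero ≡ u × p j ≡ v

HasCycle : ∀ {n} → Graph n → Set
HasCycle {n} G = ∃[ m ] Σ (Fin (suc (suc (suc m))) → Fin n) λ p →
  IsPath G p × Σ (Fin (suc (suc (suc m)))) λ j →
    toℕ j ≡ suc (suc m) × Adj G (p j) (p Data.Fin.zero)

IsTree : ∀ {n} → Graph n → Set
IsTree {n} G = n ≥ 1 × Connected G × ¬ HasCycle G

record PathDecomp {n} (G : Graph n) (w : ℕ) : Set where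
  field
    len    : ℕ
    bag    : Fin len → Subset n
    small  : ∀ i → ∣ bag i ∣ ≤ suc w
    cover  : ∀ v → ∃[ i ] v ∈ bag i
    edges  : ∀ u v → Adj G u v → ∃[ i ] (u ∈ bag i × v ∈ bag i)
    consec : ∀ v (i j k : Fin len) → toℕ i ≤ toℕ j → toℕ j ≤ toℕ k →
             v ∈ bag i → v ∈ bag k → v ∈ bag j

Pathwidth : ∀ {n} → Graph n → ℕ → Set
Pathwidth G k = PathDecomp G k × (∀ w → w < k → ¬ PathDecomp G w)

Nonrepetitive : ∀ {n} → Graph n → (Fin n → ℕ) → Set
Nonrepetitive {n} G φ = ∀ (r : ℕ) → r ≥ 1 → (p : Fin (r + r) → Fin n) →
  IsPath G p → ¬ (∀ (i : Fin r) → φ (p (i ↑ˡ r)) ≡ φ (p (r ↑ʳ i)))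

-- Every assignment of lists (sets of colours, i.e. duplicate-free lists)
-- of size ≥ ℓ admits a nonrepetitive colouring from the lists.
-- π_l(G) ≤ ℓ  iff  ThueChoosable G ℓ.
ThueChoosable : ∀ {n} → Graph n → ℕ → Set
ThueChoosable {n} G ℓ = ∀ (L : Fin n → List ℕ) →
  (∀ v → Unique (L v)) → (∀ v → length (L v) ≥ ℓ) →
  Σ (Fin n → ℕ) λ φ → (∀ v → φ v LM.∈ L v) × Nonrepetitive G φ

{-# OPTIONS --safe #-}

-- Let C be a connected set of vertices of the tree meeting every bag in at most w vertices.  A path P
-- inside C from its first bag to its last bag meets every bag that C meets, so each component of C ∖ P
-- has smaller width, and it is joined to a unique vertex t of P.  By induction on w we colour C
-- nonrepetitively such that, moreover, no path of C reads a word that occurs in one of m given colour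
-- words ("rays") at an offset at most D times its length (`Near`).
--
-- First P is coloured so that its factors are not `Near` the rays, and so that no factor x y x has |y|
-- small compared to |x|; such words exist because the number of good prefixes at least doubles with each
-- letter (Rosenfeld's counting argument).  Each component is then coloured recursively, with the two
-- colour words read from t along P in both directions as additional rays.  A path of C is a ++ b ++ e
-- with b a factor of P and a, e inside components; if it reads s ++ s, then comparing the two copies of
-- s finds a piece of a, e or b repeated in b too close to t (`++-squarefree`).
module Submission where

open import Defs hiding (sym)
open import Data.Nat using (ℕ; zero; suc; _+_; _*_; _∸_; _≤_; _<_; z≤n; s≤s; s≤s⁻¹; _≤?_)
open import Data.Nat.Properties
open import Data.Nat.Tactic.RingSolver using (solve-∀)
open import Data.Fin using (Fin; zero; suc; toℕ; fromℕ; _↑ˡ_; _↑ʳ_)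
import Data.Fin.Properties as Fin
open import Data.Fin.Subset using (Subset; ∣_∣) renaming (_∈_ to _∈ˢ_)
import Data.Fin.Subset.Properties as Subset
open import Data.List.Base using (List; []; _∷_; [_]; _++_; length; map; concatMap; filter; take; drop; reverse; upTo; cartesianProductWith; lookup; tabulate; allFin)
open import Data.List.Properties
open import Data.List.Membership.Propositional using (_∈_; _∉_; lose)
open import Data.List.Membership.Propositional.Properties
import Data.List.Membership.DecPropositional as DecMembership
open import Data.List.Relation.Unary.Any using (Any; here; there)
import Data.List.Relation.Unary.Any.Properties as Any
open import Data.List.Relation.Unary.All using (All; []; _∷_)
import Data.List.Relation.Unary.All as All
import Data.List.Relation.Unary.All.Properties as All
open import Data.List.Relation.Unary.AllPairs using ([]; _∷_)
open import Data.List.Relation.Unary.Unique.Propositional using (Unique)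
import Data.List.Relation.Unary.Unique.Propositional.Properties as Uniq
open import Data.List.Relation.Binary.Pointwise using (Pointwise; []; _∷_)
open import Data.List.Relation.Binary.Subset.Propositional using (_⊆_)
open import Data.Unit using (⊤; tt)
open import Data.Empty using (⊥; ⊥-elim)
import Data.Product as Product
open import Data.Product using (Σ; ∃₂; ∃-syntax; _×_; _,_; proj₁; proj₂)
open import Data.Sum using (_⊎_; inj₁; inj₂; map₂; [_,_]′)
open import Function using (_∘_)
open import Relation.Nullary using (¬_; Dec; yes; no; ¬?; _×-dec_)
open import Relation.Nullary.Decidable using (map′; T?)
open import Relation.Unary using (Decidable)
open import Relation.Binary.Definitions using (DecidableEquality)
open import Relation.Binary.PropositionalEquality hiding ([_])

-- Sizes of duplicate-free lists, and Rosenfeld's counting of good words.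

Unique⇒length≤ : ∀ {a} {A : Set a} {xs ys : List A} → Unique xs → xs ⊆ ys → length xs ≤ length ys
Unique⇒length≤ [] _ = z≤n
Unique⇒length≤ {xs = x ∷ xs} (x∉ ∷ uniq) sub with ∈-∃++ (sub (here refl))
... | ys , zs , refl = begin
  suc (length xs)         ≤⟨ s≤s (Unique⇒length≤ uniq sub′) ⟩
  suc (length (ys ++ zs)) ≡⟨ cong suc (length-++ ys) ⟩
  suc (length ys + length zs) ≡⟨ sym (+-suc (length ys) (length zs)) ⟩
  length ys + suc (length zs) ≡⟨ sym (length-++ ys) ⟩
  length (ys ++ x ∷ zs) ∎
  where
  open ≤-Reasoning
  sub′ : xs ⊆ ys ++ zs
  sub′ {y} y∈ with ∈-++⁻ ys (sub (there y∈))
  ... | inj₁ p           = ∈-++⁺ˡ p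
  ... | inj₂ (here refl) = ⊥-elim (All.lookup x∉ y∈ refl)
  ... | inj₂ (there p)   = ∈-++⁺ʳ ys p

length-concatMap≤ : ∀ {a b} {A : Set a} {B : Set b} (f : A → List B) {k} xs →
  (∀ x → length (f x) ≤ k) → length (concatMap f xs) ≤ length xs * k
length-concatMap≤ f [] h = z≤n
length-concatMap≤ f (x ∷ xs) h = ≤-trans (≤-reflexive (length-++ (f x))) (+-mono-≤ (h x) (length-concatMap≤ f xs h))

length-cartesianProductWith : ∀ {a b c} {A : Set a} {B : Set b} {C : Set c} (f : A → B → C) xs ys →
  length (cartesianProductWith f xs ys) ≡ length xs * length ys
length-cartesianProductWith f [] ys = refl
length-cartesianProductWith f (x ∷ xs) ys =
  trans (length-++ (map (f x) ys)) (cong₂ _+_ (length-map (f x) ys) (length-cartesianProductWith f xs ys))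

-- Words grow at the head, and F e rest lists the words of length e that must not be put in front of rest.
module Counting (F : ℕ → List ℕ → List (List ℕ)) (c : ℕ) (F-size : ∀ e rest → length (F (suc e) rest) ≤ suc e * c) where

  open DecMembership (≡-dec _≟_) using () renaming (_∈?_ to _∈ʷ?_)

  mutual
    -- One letter comes from each list. Filtering by `bad 1 ls` removes the words with a forbidden
    -- factor starting at the new letter; later positions were settled when the tail was built.
    words : List (List ℕ) → List (List ℕ)
    words []       = [] ∷ []
    words (l ∷ ls) = filter (λ u → ¬? (u ∈ʷ? bad 1 ls)) (cartesianProductWith _∷_ l (words ls))

    -- bad e ls collects x ++ rest with x forbidden, over the good words rest for ls (then |x| ≡ e) and
    -- for all tails of ls (then |x| is larger by the number of lists dropped).
    bad : ℕ → List (List ℕ) → List (List ℕ)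
    bad e ls = concatMap (λ rest → map (_++ rest) (F e rest)) (words ls) ++ longer e ls

    longer : ℕ → List (List ℕ) → List (List ℕ)
    longer e []       = []
    longer e (l ∷ ls) = bad (suc e) ls

  words-unique : ∀ {ls} → All Unique ls → Unique (words ls)
  words-unique []       = [] ∷ []
  words-unique (u ∷ us) = Uniq.filter⁺ _ (Uniq.cartesianProductWith⁺ _∷_ ∷-injective u (words-unique us))

  private
    size : List (List ℕ) → ℕ
    size ls = length (words ls)

  mutual
    -- Every good word for `ls` has at least `2 + 4 * c` extensions. By `bad-size 0` at most `4 * c`
    -- per good word are lost on average, so twice as many words survive.
    growth : ∀ {l ls} → All Unique (l ∷ ls) → All (λ l → 2 + 4 * c ≤ length l) (l ∷ ls) →
             2 * size ls ≤ size (l ∷ ls)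
    growth {l} {ls} (u ∷ us) (big ∷ bigs) = +-cancelʳ-≤ (size ls * (4 * c)) _ _ (begin
      2 * size ls + size ls * (4 * c)   ≡⟨ lem (size ls) c ⟩
      (2 + 4 * c) * size ls             ≤⟨ *-monoˡ-≤ (size ls) big ⟩
      length l * size ls                ≡⟨ sym (length-cartesianProductWith _∷_ l (words ls)) ⟩
      length cands                      ≤⟨ Unique⇒length≤ (Uniq.cartesianProductWith⁺ _∷_ ∷-injective u (words-unique us)) sub ⟩
      length (words (l ∷ ls) ++ bad 1 ls) ≡⟨ length-++ (words (l ∷ ls)) ⟩
      size (l ∷ ls) + length (bad 1 ls) ≤⟨ +-monoʳ-≤ (size (l ∷ ls)) (bad-size 0 us bigs) ⟩
      size (l ∷ ls) + size ls * (4 * c) ∎)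
      where
      open ≤-Reasoning
      cands = cartesianProductWith _∷_ l (words ls)
      lem : ∀ s c → 2 * s + s * (4 * c) ≡ (2 + 4 * c) * s
      lem = solve-∀
      sub : cands ⊆ words (l ∷ ls) ++ bad 1 ls
      sub {v} v∈ with v ∈ʷ? bad 1 ls
      ... | yes b = ∈-++⁺ʳ (words (l ∷ ls)) b
      ... | no ¬b = ∈-++⁺ˡ (∈-filter⁺ _ v∈ ¬b)

    -- Forbidden words of index `e + 1 + i` stand in front of a good word for `ls` without its first
    -- `i` lists, and by `growth` there are at most `size ls / 2^i` of those. The factor `2 * e + 4`
    -- is the sum of `(e + 1 + i) / 2^i` over all `i`.
    bad-size : ∀ e {ls} → All Unique ls → All (λ l → 2 + 4 * c ≤ length l) ls →
               length (bad (suc e) ls) ≤ size ls * ((2 * e + 4) * c)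
    bad-size e {ls} us bigs = begin
      length (bad (suc e) ls)                 ≡⟨ length-++ (concatMap _ (words ls)) ⟩
      length (concatMap _ (words ls)) + length (longer (suc e) ls) ≤⟨ +-mono-≤ here-size (longer-size e us bigs) ⟩
      size ls * (suc e * c) + size ls * ((e + 3) * c) ≡⟨ lem (size ls) e c ⟩
      size ls * ((2 * e + 4) * c) ∎
      where
      open ≤-Reasoning
      here-size = length-concatMap≤ (λ rest → map (_++ rest) (F (suc e) rest)) (words ls)
        (λ rest → ≤-trans (≤-reflexive (length-map _ (F (suc e) rest))) (F-size e rest))
      lem : ∀ s e c → s * (suc e * c) + s * ((e + 3) * c) ≡ s * ((2 * e + 4) * c)
      lem = solve-∀

    longer-size : ∀ e {ls} → All Unique ls → All (λ l → 2 + 4 * c ≤ length l) ls →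
                  length (longer (suc e) ls) ≤ size ls * ((e + 3) * c)
    longer-size e {[]} _ _ = z≤n
    longer-size e {l ∷ ls} us@(_ ∷ us′) bigs@(_ ∷ bigs′) = begin
      length (bad (2 + e) ls)               ≤⟨ bad-size (suc e) us′ bigs′ ⟩
      size ls * ((2 * suc e + 4) * c)       ≡⟨ lem (size ls) e c ⟩
      2 * size ls * ((e + 3) * c)           ≤⟨ *-monoˡ-≤ ((e + 3) * c) (growth us bigs) ⟩
      size (l ∷ ls) * ((e + 3) * c) ∎
      where
      open ≤-Reasoning
      lem : ∀ s e c → s * ((2 * suc e + 4) * c) ≡ 2 * s * ((e + 3) * c)
      lem = solve-∀

  words-nonempty : ∀ {ls} → All Unique ls → All (λ l → 2 + 4 * c ≤ length l) ls → 1 ≤ size ls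
  words-nonempty {[]} _ _ = s≤s z≤n
  words-nonempty {l ∷ ls} us@(_ ∷ us′) bigs@(_ ∷ bigs′) =
    ≤-trans (words-nonempty us′ bigs′) (≤-trans (m≤n*m (size ls) 2) (growth us bigs))

  words-uncons : ∀ {l ls u} → u ∈ words (l ∷ ls) →
    u ∉ bad 1 ls × ∃₂ λ a v → u ≡ a ∷ v × a ∈ l × v ∈ words ls
  words-uncons {l} {ls} {u} u∈ with ∈-filter⁻ (λ u → ¬? (u ∈ʷ? bad 1 ls)) {xs = cartesianProductWith _∷_ l (words ls)} u∈
  ... | u∈cands , ∉bad with ∈-cartesianProductWith⁻ _∷_ l (words ls) u∈cands
  ... | a , v , a∈ , v∈ , eq = ∉bad , a , v , eq , a∈ , v∈

  words-Pointwise : ∀ {ls u} → u ∈ words ls → Pointwise _∈_ u ls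
  words-Pointwise {[]} (here refl) = []
  words-Pointwise {l ∷ ls} u∈ with words-uncons {l} {ls} u∈
  ... | _ , a , v , refl , a∈ , v∈ = a∈ ∷ words-Pointwise {ls} v∈

  -- Each letter of `y` is one step into `longer`, which raises the index by one. In `words-avoid`,
  -- `y` is the tail of the forbidden word and `e` is 1, so the final index is the length of that
  -- word.
  ∈-bad : ∀ e x y rest {ls} → y ++ rest ∈ words ls → x ∈ F (e + length y) rest → x ++ rest ∈ bad e ls
  ∈-bad e x [] rest {ls} v∈ x∈ rewrite +-identityʳ e =
    ∈-++⁺ˡ (∈-concatMap⁺ _ (Any-map v∈))
    where
    Any-map : ∀ {ws} → rest ∈ ws → Any (λ r → x ++ rest ∈ map (_++ r) (F e r)) ws
    Any-map (here refl) = here (∈-map⁺ (_++ rest) x∈)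
    Any-map (there p)   = there (Any-map p)
  ∈-bad e x (b ∷ y) rest {[]} (here ()) x∈
  ∈-bad e x (b ∷ y) rest {[]} (there ()) x∈
  ∈-bad e x (b ∷ y) rest {l ∷ ls} v∈ x∈ with words-uncons {l} {ls} v∈
  ... | _ , _ , _ , refl , _ , v∈′ =
    ∈-++⁺ʳ (concatMap _ (words (l ∷ ls))) (∈-bad (suc e) x y rest {ls} v∈′ (subst (λ k → x ∈ F k rest) (+-suc e (length y)) x∈))

  words-avoid : ∀ {ls u} → u ∈ words ls → ∀ pre a x rest → u ≡ pre ++ a ∷ x ++ rest → a ∷ x ∉ F (suc (length x)) rest
  words-avoid {[]} (here refl) [] a x rest () _
  words-avoid {[]} (here refl) (_ ∷ pre) a x rest () _
  words-avoid {l ∷ ls} u∈ pre a x rest eq ∈F with words-uncons {l} {ls} u∈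
  words-avoid {l ∷ ls} u∈ [] a x rest refl ∈F | ∉bad , _ , _ , refl , _ , v∈ = ∉bad (∈-bad 1 (a ∷ x) x rest {ls} v∈ ∈F)
  words-avoid {l ∷ ls} u∈ (b ∷ pre) a x rest refl ∈F | _ , _ , _ , refl , _ , v∈ = words-avoid {ls} v∈ pre a x rest refl ∈F

  good-word : ∀ ls → All Unique ls → All (λ l → 2 + 4 * c ≤ length l) ls →
    ∃[ u ] Pointwise _∈_ u ls × (∀ pre a x rest → u ≡ pre ++ a ∷ x ++ rest → a ∷ x ∉ F (suc (length x)) rest)
  good-word ls us bigs with words ls in eq | words-nonempty us bigs
  ... | u ∷ _ | _ = u , words-Pointwise {ls} u∈ , words-avoid {ls} u∈
    where
    u∈ : u ∈ words ls
    u∈ = subst (u ∈_) (sym eq) (here refl)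

-- Occurrences near the start of a word, and the colour word of the spine.

-- Letting the offset grow in proportion to `x` keeps the number of forbidden words of each length
-- linear in that length, which is what `Counting` can afford.
Near : ℕ → List ℕ → List ℕ → Set
Near D x z = ∃₂ λ pre post → z ≡ pre ++ x ++ post × length pre ≤ D * length x

Near-mono : ∀ {D D′ x z} → D ≤ D′ → Near D x z → Near D′ x z
Near-mono {x = x} le (pre , post , eq , h) = pre , post , eq , ≤-trans h (*-monoˡ-≤ (length x) le)

drop-length-++ : ∀ {a} {A : Set a} (xs ys : List A) → drop (length xs) (xs ++ ys) ≡ ys
drop-length-++ []       ys = refl
drop-length-++ (x ∷ xs) ys = drop-length-++ xs ys

take-length-++ : ∀ {a} {A : Set a} (xs ys : List A) → take (length xs) (xs ++ ys) ≡ xs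
take-length-++ []       ys = refl
take-length-++ (x ∷ xs) ys = cong (x ∷_) (take-length-++ xs ys)

module _ (D : ℕ) where

  window : ℕ → List ℕ → ℕ → List ℕ
  window e z d = take e (drop d z)

  -- A path may run along the spine in either direction, so the reversed window has to be avoided
  -- too.
  window± : ℕ → List ℕ → ℕ → List (List ℕ)
  window± e z d = window e z d ∷ reverse (window e z d) ∷ []

  windows : ℕ → List ℕ → List (List ℕ)
  windows e z = concatMap (window± e z) (upTo (suc (D * e)))

  window-Near : ∀ x z pre {post} → z ≡ pre ++ x ++ post → window (length x) z (length pre) ≡ x
  window-Near x _ pre {post} refl =
    trans (cong (take (length x)) (drop-length-++ pre (x ++ post))) (take-length-++ x post)

  Near⇒∈windows : ∀ x z → Near D x z ⊎ Near D (reverse x) z → x ∈ windows (length x) z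
  Near⇒∈windows x z (inj₁ (pre , post , eq , le)) =
    ∈-concatMap⁺ (window± (length x) z) (lose (∈-upTo⁺ (s≤s le)) (here (sym (window-Near x z pre eq))))
  Near⇒∈windows x z (inj₂ (pre , post , eq , le)) =
    ∈-concatMap⁺ (window± (length x) z) (lose (∈-upTo⁺ (s≤s le′)) (there (here (sym window≡))))
    where
    le′ : length pre ≤ D * length x
    le′ = subst (λ k → length pre ≤ D * k) (length-reverse x) le
    window≡ : reverse (window (length x) z (length pre)) ≡ x
    window≡ = trans (cong reverse (trans (cong (λ k → window k z (length pre)) (sym (length-reverse x)))
                                         (window-Near (reverse x) z pre eq)))
                    (reverse-involutive x)

  -- `suc m` counts the `m` rays and the word's own continuation; `suc D * e` bounds the number
  -- `D * e + 1` of offsets for length `e ≥ 1`; 2 is for the two directions.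
  spineConst : ℕ → ℕ
  spineConst m = suc m * (suc D * 2)

  module _ (R : List (List ℕ)) where

    -- Counting `rest` as one more ray rules out factors `x ++ y ++ x` in which `y` is short
    -- compared with `x`.
    forbidden : ℕ → List ℕ → List (List ℕ)
    forbidden e rest = concatMap (windows e) (rest ∷ R)

    forbidden-size : ∀ {m} → length R ≤ m → ∀ e rest → length (forbidden (suc e) rest) ≤ suc e * spineConst m
    forbidden-size {m} le e rest = begin
      length (forbidden (suc e) rest)             ≤⟨ length-concatMap≤ (windows (suc e)) (rest ∷ R) windows-size ⟩
      suc (length R) * (suc (D * suc e) * 2)      ≤⟨ *-mono-≤ (s≤s le) (*-monoˡ-≤ 2 (s≤s (m≤n+m (D * suc e) e))) ⟩
      suc m * ((suc D * suc e) * 2)               ≡⟨ lem m D e ⟩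
      suc e * spineConst m ∎
      where
      open ≤-Reasoning
      windows-size : ∀ z → length (windows (suc e) z) ≤ suc (D * suc e) * 2
      windows-size z = ≤-trans (length-concatMap≤ (window± (suc e) z) (upTo (suc (D * suc e))) (λ _ → ≤-refl))
                               (≤-reflexive (cong (_* 2) (length-upTo (suc (D * suc e)))))
      lem : ∀ m D e → suc m * ((suc D * suc e) * 2) ≡ suc e * (suc m * (suc D * 2))
      lem = solve-∀

    spine-word : ∀ {m} → length R ≤ m → ∀ ls → All Unique ls → All (λ l → 2 + 4 * spineConst m ≤ length l) ls →
      ∃[ u ] Pointwise _∈_ u ls ×
        (∀ pre x rest z → u ≡ pre ++ x ++ rest → x ≢ [] → z ∈ rest ∷ R → ¬ (Near D x z ⊎ Near D (reverse x) z))
    spine-word {m} le ls us bigs with Counting.good-word forbidden (spineConst m) (forbidden-size le) ls us bigs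
    ... | u , pw , avoid = u , pw , λ
      { pre []      rest z eq x≢[] z∈ near → x≢[] refl
      ; pre (a ∷ x) rest z eq x≢[] z∈ near →
          avoid pre a x rest eq (∈-concatMap⁺ (windows _) (lose z∈ (Near⇒∈windows (a ∷ x) z near))) }

-- Levi's lemma, and squares in a product of three words.

++-split : ∀ {a} {A : Set a} (as bs cs ds : List A) → as ++ bs ≡ cs ++ ds →
  (∃[ m ] cs ≡ as ++ m × bs ≡ m ++ ds) ⊎ (∃[ m ] as ≡ cs ++ m × ds ≡ m ++ bs)
++-split []       bs cs       ds eq = inj₁ (cs , refl , eq)
++-split (a ∷ as) bs []       ds eq = inj₂ (a ∷ as , refl , sym eq)
++-split (a ∷ as) bs (c ∷ cs) ds eq with ∷-injective eq
... | refl , eq′ with ++-split as bs cs ds eq′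
... | inj₁ (m , refl , q) = inj₁ (m , refl , q)
... | inj₂ (m , refl , q) = inj₂ (m , refl , q)

private
  triangle : ∀ a b c → 2 * a < b + c → 2 * b ≤ c + a → 2 * c ≤ a + b → ⊥
  triangle a b c p q r = <-irrefl (lem a b c) (+-mono-<-≤ p (+-mono-≤ q r))
    where
    lem : ∀ a b c → 2 * a + (2 * b + 2 * c) ≡ b + c + (c + a + (a + b))
    lem = solve-∀

module _ {a} {A : Set a} where

  private
    weaken : (x : List A) {p : ℕ} → (x ≢ [] → ¬ p ≤ 2 * length x) → 2 * length x ≤ p
    weaken []      h = z≤n
    weaken (_ ∷ _) h = <⇒≤ (≰⇒> (h λ ()))

    -- Each nonempty piece is shorter than half of the other two together. If `x` is nonempty,
    -- adding the three inequalities gives a contradiction.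
    triple : (x y z : List A) →
      (x ≢ [] → ¬ (length y + length z ≤ 2 * length x)) →
      (y ≢ [] → ¬ (length z + length x ≤ 2 * length y)) →
      (z ≢ [] → ¬ (length x + length y ≤ 2 * length z)) →
      x ≡ []
    triple [] y z hx hy hz = refl
    triple x@(_ ∷ _) y z hx hy hz =
      ⊥-elim (triangle (length x) (length y) (length z) (≰⇒> (hx λ ())) (weaken y hy) (weaken z hz))

    pair : (x y : List A) →
      (x ≢ [] → ¬ (length y ≤ 2 * length x)) →
      (y ≢ [] → ¬ (length x ≤ 2 * length y)) → x ≡ []
    pair [] y hx hy = refl
    pair x@(_ ∷ _) y hx hy = ⊥-elim (<-irrefl refl (begin-strict
      length x             ≤⟨ m≤n*m (length x) 2 ⟩
      2 * length x         <⟨ ≰⇒> (hx λ ()) ⟩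
      length y             ≤⟨ m≤n*m (length y) 2 ⟩
      2 * length y         ≤⟨ weaken y hy ⟩
      length x ∎))
      where open ≤-Reasoning

  -- If neither a nor e covers s, then s ≡ a ++ p ≡ q ++ e and b ≡ p ++ q.  Overlaying these two
  -- factorisations of s places the pieces of a and e inside b, and their offsets cannot all be large.
  ++-squarefree : ∀ (a b e s : List A) → b ≢ [] →
    (∀ b₁ x b₂ a₁ a₂ → b ≡ b₁ ++ x ++ b₂ → a ≡ a₁ ++ x ++ a₂ → x ≢ [] → ¬ length b₁ ≤ 2 * length x) →
    (∀ b₁ x b₂ e₁ e₂ → b ≡ b₁ ++ x ++ b₂ → e ≡ e₁ ++ x ++ e₂ → x ≢ [] → ¬ length b₂ ≤ 2 * length x) →
    (∀ b₁ x y b₂ → b ≡ b₁ ++ x ++ y ++ x ++ b₂ → x ≢ [] → ¬ length y ≤ 2 * length x) →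
    a ++ b ++ e ≢ s ++ s
  ++-squarefree a b e s b≢[] h₁ h₂ h₃ eq with ++-split a (b ++ e) s s eq
  -- The first copy of `s` lies inside `a`. The second contains all of `b`, so `b` also occurs in
  -- `a`, and its offset in `b` is 0.
  ... | inj₂ (a′ , refl , refl) =
    h₁ [] b [] a′ (e ++ a′) (sym (++-identityʳ b)) (trans (++-assoc a′ (b ++ e) a′) (cong (a′ ++_) (++-assoc b e a′))) b≢[] z≤n
  ... | inj₁ (p , s≡ , eq′) with ++-split p s b e (sym eq′)
  ... | inj₂ (e′ , p≡ , e≡) =
    h₂ [] b [] (e′ ++ a) e′ (sym (++-identityʳ b))
       (trans e≡ (trans (cong (e′ ++_) (trans s≡ (cong (a ++_) p≡))) (sym (++-assoc e′ a (b ++ e′))))) b≢[] z≤n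
  ... | inj₁ (q , b≡ , s≡′) with ++-split a p q e (trans (sym s≡) s≡′)
  -- Here `s` is `a ++ m ++ e` and `b` is `m ++ e ++ a ++ m`. For each of `a`, `m` and `e` the
  -- offset or gap to be compared with it is the total length of the other two.
  ... | inj₁ (m , refl , refl) = b≢[] (trans b≡ (cong₂ _++_ (cong₂ _++_ m≡[] e≡[]) (cong₂ _++_ a≡[] m≡[])))
    where
    len : ∀ (x y : List A) {k} → ¬ length (x ++ y) ≤ k → ¬ length x + length y ≤ k
    len x y {k} = subst (λ l → ¬ l ≤ k) (length-++ x)
    b≡′ : b ≡ m ++ e ++ a ++ m
    b≡′ = trans b≡ (++-assoc m e (a ++ m))
    ha : a ≢ [] → ¬ length m + length e ≤ 2 * length a
    ha n = len m e (h₁ (m ++ e) a m [] [] b≡ (sym (++-identityʳ a)) n)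
    he : e ≢ [] → ¬ length a + length m ≤ 2 * length e
    he n = len a m (h₂ m e (a ++ m) [] [] b≡′ (sym (++-identityʳ e)) n)
    hm : m ≢ [] → ¬ length e + length a ≤ 2 * length m
    hm n = len e a (h₃ [] m (e ++ a) []
      (trans b≡′ (cong (m ++_) (trans (cong (λ k → e ++ a ++ k) (sym (++-identityʳ m))) (sym (++-assoc e a (m ++ [])))))) n)
    a≡[] : a ≡ []
    a≡[] = triple a m e ha hm he
    m≡[] : m ≡ []
    m≡[] = triple m e a hm he ha
    e≡[] : e ≡ []
    e≡[] = triple e a m he ha hm
  -- Here `a` and `e` overlap in `m`: `s` is `q ++ m ++ p` and `b` is `p ++ q`, with `q` a prefix of
  -- `a` and `p` a suffix of `e`.
  ... | inj₂ (m , refl , refl) = b≢[] (trans b≡ (cong₂ _++_ (pair p q hp hq) (pair q p hq hp)))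
    where
    hq : q ≢ [] → ¬ length p ≤ 2 * length q
    hq = h₁ p q [] [] m (trans b≡ (cong (p ++_) (sym (++-identityʳ q)))) refl
    hp : p ≢ [] → ¬ length q ≤ 2 * length p
    hp = h₂ [] p q m [] b≡ (cong (m ++_) (sym (++-identityʳ p)))

-- Duplicate-free lists and walks in a graph.

Unique-++⁻ : ∀ {a} {A : Set a} (xs : List A) {ys} → Unique (xs ++ ys) →
  Unique xs × Unique ys × (∀ {z} → z ∈ xs → z ∉ ys)
Unique-++⁻ []       u        = [] , u , λ ()
Unique-++⁻ (x ∷ xs) (x∉ ∷ u) with Unique-++⁻ xs u
... | uxs , uys , disj = All.++⁻ˡ xs x∉ ∷ uxs , uys , λ
  { (here refl) z∈ys → All.lookup (All.++⁻ʳ xs x∉) z∈ys refl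
  ; (there z∈)  z∈ys → disj z∈ z∈ys }

Unique-infix : ∀ {a} {A : Set a} (xs ys : List A) {zs} → Unique (xs ++ ys ++ zs) → Unique ys
Unique-infix xs ys u = proj₁ (Unique-++⁻ ys (proj₁ (proj₂ (Unique-++⁻ xs u))))

Unique-reverse : ∀ {a} {A : Set a} {xs : List A} → Unique xs → Unique (reverse xs)
Unique-reverse []       = []
Unique-reverse {xs = x ∷ xs} (x∉ ∷ u) = subst Unique (sym (unfold-reverse x xs))
  (Uniq.++⁺ (Unique-reverse u) ([] ∷ []) λ { (z∈ , here refl) → All.lookup x∉ (Any.reverse⁻ z∈) refl })

All-reverse : ∀ {a p} {A : Set a} {P : A → Set p} {xs : List A} → All P xs → All P (reverse xs)
All-reverse pxs = All.tabulate (All.lookup pxs ∘ Any.reverse⁻)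

lookup-injective : ∀ {a} {A : Set a} {xs : List A} → Unique xs → ∀ {i j} → lookup xs i ≡ lookup xs j → i ≡ j
lookup-injective (_ ∷ _)  {zero}  {zero}  eq = refl
lookup-injective {xs = x ∷ xs} (x∉ ∷ _) {zero}  {suc j} eq = ⊥-elim (All.lookup x∉ (∈-lookup j) eq)
lookup-injective {xs = x ∷ xs} (x∉ ∷ _) {suc i} {zero}  eq = ⊥-elim (All.lookup x∉ (∈-lookup i) (sym eq))
lookup-injective (_ ∷ u)  {suc i} {suc j} eq = cong suc (lookup-injective u eq)

module Walks {n : ℕ} (G : Graph n) where

  private
    V = Fin n

  open DecMembership (Fin._≟_ {n}) using (_∈?_) public

  -- The index lists the visited vertices with both ends, so walks can be cut and compared as lists.
  -- A path is a walk whose list is `Unique`.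
  data Walk : V → List V → V → Set where
    stop : ∀ {u} → Walk u (u ∷ []) u
    step : ∀ {u v w xs} → Adj G u v → Walk v xs w → Walk u (u ∷ xs) w

  first∈ : ∀ {u xs v} → Walk u xs v → u ∈ xs
  first∈ stop       = here refl
  first∈ (step _ _) = here refl

  first-cons : ∀ {u xs v} → Walk u xs v → ∃[ ys ] xs ≡ u ∷ ys
  first-cons stop       = _ , refl
  first-cons (step _ _) = _ , refl

  last∈ : ∀ {u xs v} → Walk u xs v → v ∈ xs
  last∈ stop       = here refl
  last∈ (step _ p) = there (last∈ p)

  join : ∀ {u xs v ys w} → Walk u xs v → Walk v (v ∷ ys) w → Walk u (xs ++ ys) w
  join stop       q = q
  join (step a p) q = step a (join p q)

  link : ∀ {u xs v w ys z} → Walk u xs v → Adj G v w → Walk w ys z → Walk u (xs ++ ys) z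
  link p a q = join p (step a q)

  compose : ∀ {u xs v ys w} → Walk u xs v → Walk v ys w →
    ∃[ zs ] Walk u zs w × (∀ {x} → x ∈ zs → x ∈ xs ⊎ x ∈ ys)
  compose {xs = xs} p stop         = xs , p , inj₁
  compose {xs = xs} p q@(step _ _) = _ , join p q , λ x∈ → map₂ there (∈-++⁻ xs x∈)

  reverse-walk : ∀ {u xs v} → Walk u xs v → Walk v (reverse xs) u
  reverse-walk stop = stop
  reverse-walk (step {u} {v} {w} {xs} a p) =
    subst (λ l → Walk w l u) (sym (unfold-reverse u xs)) (link (reverse-walk p) (Graph.sym G u v a) stop)

  split-at : ∀ xs {u t ys v} → Walk u (xs ++ t ∷ ys) v → Walk u (xs ++ [ t ]) t × Walk t (t ∷ ys) v
  split-at xs p = go xs p refl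
    where
    go : ∀ xs {u zs t ys v} → Walk u zs v → zs ≡ xs ++ t ∷ ys → Walk u (xs ++ [ t ]) t × Walk t (t ∷ ys) v
    go []           stop       refl = stop , stop
    go []           (step a p) refl = stop , step a p
    go (x ∷ [])     stop       ()
    go (x ∷ y ∷ xs) stop       ()
    go (x ∷ xs)     (step a p) refl with go xs p refl
    ... | l , r = step a l , r

  left-leg : ∀ xs {u t ys v} → Walk u (xs ++ t ∷ ys) v → xs ≡ [] ⊎ ∃[ k ] Walk u xs k × Adj G k t
  left-leg xs p = go xs p refl
    where
    go : ∀ xs {u zs t ys v} → Walk u zs v → zs ≡ xs ++ t ∷ ys → xs ≡ [] ⊎ ∃[ k ] Walk u xs k × Adj G k t
    go []           p          eq = inj₁ refl
    go (x ∷ [])     stop       ()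
    go (x ∷ y ∷ xs) stop       ()
    go (x ∷ [])     (step a stop)       refl = inj₂ (x , stop , a)
    go (x ∷ [])     (step a (step _ _)) refl = inj₂ (x , stop , a)
    go (x ∷ y ∷ xs) (step a p) refl with go (y ∷ xs) p refl
    ... | inj₂ (k , q , b) = inj₂ (k , step a q , b)

  right-leg : ∀ {t ys v} → Walk t (t ∷ ys) v → ys ≡ [] ⊎ ∃[ k ] Adj G t k × Walk k ys v
  right-leg stop       = inj₁ refl
  right-leg (step a p) = inj₂ (_ , a , p)

  infix-walk : ∀ xs ys {zs u v} → Walk u (xs ++ ys ++ zs) v → ys ≢ [] → ∃₂ λ s t → Walk s ys t
  infix-walk xs []       p ne = ⊥-elim (ne refl)
  infix-walk xs (y ∷ ys) {[]} {v = v} p ne =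
    y , v , subst (λ l → Walk y l v) (cong (y ∷_) (++-identityʳ ys)) (proj₂ (split-at xs p))
  infix-walk xs (y ∷ ys) {z ∷ zs} p ne with left-leg (y ∷ ys) (proj₂ (split-at xs p))
  ... | inj₂ (k , q , _) = y , k , q

  -- Loop erasure: if the new first vertex already lies on the shortened walk, only the part from
  -- that vertex on is kept.
  erase : ∀ {u xs v} → Walk u xs v → ∃[ ys ] Walk u ys v × Unique ys × ys ⊆ xs
  erase stop = _ , stop , [] ∷ [] , λ z → z
  erase (step {u} a p) with erase p
  ... | ys , q , uniq , sub with u ∈? ys
  ... | no  u∉ = u ∷ ys , step a q , All.tabulate (λ { y∈ refl → u∉ y∈ }) ∷ uniq ,
                 λ { (here eq) → here eq ; (there y∈) → there (sub y∈) }
  ... | yes u∈ with ∈-∃++ u∈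
  ... | as , bs , refl = u ∷ bs , proj₂ (split-at as q) , proj₁ (proj₂ (Unique-++⁻ as uniq)) ,
                         λ y∈ → there (sub (∈-++⁺ʳ as y∈))

  lookup-adj : ∀ {u xs v} → Walk u xs v → ∀ i j → suc (toℕ i) ≡ toℕ j → Adj G (lookup xs i) (lookup xs j)
  lookup-adj stop zero zero ()
  lookup-adj (step a stop)       zero    (suc zero) _ = a
  lookup-adj (step a (step _ _)) zero    (suc zero) _ = a
  lookup-adj (step a p)          (suc i) (suc j)    e = lookup-adj p i j (suc-injective e)

  last-index : ∀ {u x xs v} → Walk u (x ∷ xs) v → ∃[ j ] toℕ j ≡ length xs × lookup (x ∷ xs) j ≡ v
  last-index stop = zero , refl , refl
  last-index (step a p@stop) with last-index p
  ... | j , e , l = suc j , cong suc e , l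
  last-index (step a p@(step _ _)) with last-index p
  ... | j , e , l = suc j , cong suc e , l

  tabulate-walk : ∀ {m} (p : Fin (suc m) → V) → (∀ i j → suc (toℕ i) ≡ toℕ j → Adj G (p i) (p j)) →
    Walk (p zero) (tabulate p) (p (fromℕ m))
  tabulate-walk {zero}  p h = stop
  tabulate-walk {suc m} p h =
    step (h zero (suc zero) refl) (tabulate-walk (p ∘ suc) (λ i j e → h (suc i) (suc j) (cong suc e)))

  -- Uniqueness of paths in an acyclic graph.

  module Acyclic (acyclic : ¬ HasCycle G) where

    -- Loop erasure gives a path from `a` to `b` that avoids `u`, and the two edges at `u` close it
    -- to a cycle. It has at least three vertices because `a ≢ b`.
    no-detour : ∀ {u a b xs} → a ≢ b → Adj G u a → Adj G u b → Walk a xs b → u ∉ xs → ⊥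
    no-detour {u} {a} {b} a≢b ua ub p u∉ with erase p
    ... | _ , stop , _ , _ = a≢b refl
    ... | _ ∷ [] , step _ () , _ , _
    ... | ys@(_ ∷ y ∷ zs) , q@(step _ _) , uniq , sub with last-index (step ua q)
    ... | j , j≡ , j-last = acyclic
      (length zs , lookup (u ∷ ys) , (lookup-injective (u≢ys ∷ uniq) , lookup-adj (step ua q)) ,
       j , j≡ , subst (λ k → Adj G k u) (sym j-last) (Graph.sym G u b ub))
      where
      u≢ys : All (u ≢_) ys
      u≢ys = All.tabulate λ { y∈ refl → u∉ (sub y∈) }

    -- Where two paths first part, towards `a` and `b`, following one to the end and the other back
    -- leads from `a` to `b` without visiting `u` again.
    path-unique : ∀ {u xs ys v} → Walk u xs v → Unique xs → Walk u ys v → Unique ys → xs ≡ ys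
    path-unique stop       _        stop       _        = refl
    path-unique stop       _        (step _ q) (u∉ ∷ _) = ⊥-elim (All.lookup u∉ (last∈ q) refl)
    path-unique (step _ p) (u∉ ∷ _) stop       _        = ⊥-elim (All.lookup u∉ (last∈ p) refl)
    path-unique (step {u} {a} ua p) (u∉p ∷ up) (step {v = b} {xs = ys} ub q) (u∉q ∷ uq) with a Fin.≟ b
    ... | yes refl = cong (u ∷_) (path-unique p up q uq)
    ... | no  a≢b  = ⊥-elim (no-detour a≢b ua ub (proj₁ (proj₂ detour)) u∉)
      where
      detour = compose p (reverse-walk q)
      u∉ : u ∉ proj₁ detour
      u∉ u∈ with proj₂ (proj₂ detour) u∈
      ... | inj₁ u∈p = All.lookup u∉p u∈p refl
      ... | inj₂ u∈q = All.lookup u∉q (Any.reverse⁻ u∈q) refl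

-- Searching in lists, assigning colours along a list, and list identities.

map-++⁻ : ∀ {a b} {A : Set a} {B : Set b} (f : A → B) xs us {vs} → map f xs ≡ us ++ vs →
  ∃₂ λ ys zs → xs ≡ ys ++ zs × map f ys ≡ us × map f zs ≡ vs
map-++⁻ f xs       []       eq = [] , xs , refl , refl , eq
map-++⁻ f (x ∷ xs) (u ∷ us) eq with ∷-injective eq
... | refl , eq′ with map-++⁻ f xs us eq′
... | ys , zs , refl , refl , refl = x ∷ ys , zs , refl , refl , refl

module _ {a p} {A : Set a} {P : A → Set p} (P? : Decidable P) where

  split-first : ∀ xs → All (¬_ ∘ P) xs ⊎ ∃[ ys ] ∃[ x ] ∃[ zs ] xs ≡ ys ++ x ∷ zs × All (¬_ ∘ P) ys × P x
  split-first [] = inj₁ []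
  split-first (x ∷ xs) with P? x | split-first xs
  ... | yes px | _ = inj₂ ([] , x , xs , refl , [] , px)
  ... | no ¬px | inj₁ none = inj₁ (¬px ∷ none)
  ... | no ¬px | inj₂ (ys , y , zs , refl , none , py) = inj₂ (x ∷ ys , y , zs , refl , ¬px ∷ none , py)

  split-last : ∀ xs → All (¬_ ∘ P) xs ⊎ ∃[ ys ] ∃[ x ] ∃[ zs ] xs ≡ ys ++ x ∷ zs × P x × All (¬_ ∘ P) zs
  split-last [] = inj₁ []
  split-last (x ∷ xs) with split-last xs | P? x
  ... | inj₂ (ys , y , zs , refl , py , none) | _ = inj₂ (x ∷ ys , y , zs , refl , py , none)
  ... | inj₁ none | yes px = inj₂ ([] , x , xs , refl , px , none)
  ... | inj₁ none | no ¬px = inj₁ (¬px ∷ none)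

  -- The default d is returned when no member of the list satisfies P.
  first : A → List A → A
  first d []       = d
  first d (x ∷ xs) with P? x
  ... | yes _ = x
  ... | no  _ = first d xs

  first-sat : ∀ d {x xs} → x ∈ xs → P x → P (first d xs)
  first-sat d {xs = y ∷ _} x∈ px with P? y
  first-sat d x∈          px | yes py = py
  first-sat d (here refl) px | no ¬py = ⊥-elim (¬py px)
  first-sat d (there x∈)  px | no ¬py = first-sat d x∈ px

  argmin : (f : A → ℕ) → ∀ a → P a → ∀ xs → ∃[ b ] P b × f b ≤ f a × All (λ x → P x → f b ≤ f x) xs
  argmin f a pa [] = a , pa , ≤-refl , []
  argmin f a pa (x ∷ xs) with argmin f a pa xs | P? x
  ... | b , pb , b≤a , b≤xs | no ¬px = b , pb , b≤a , (⊥-elim ∘ ¬px) ∷ b≤xs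
  ... | b , pb , b≤a , b≤xs | yes px with ≤-total (f b) (f x)
  ... | inj₁ b≤x = b , pb , b≤a , (λ _ → b≤x) ∷ b≤xs
  ... | inj₂ x≤b = x , px , ≤-trans x≤b b≤a , (λ _ → ≤-refl) ∷ All.map (λ h py → ≤-trans x≤b (h py)) b≤xs

-- The witness `x` keeps both searches from falling through to their defaults, so `d` and `e` may
-- differ.
first-cong : ∀ {a p q} {A : Set a} {P : A → Set p} {Q : A → Set q} (P? : Decidable P) (Q? : Decidable Q) →
  (∀ {x} → P x → Q x) → (∀ {x} → Q x → P x) →
  ∀ d e {x xs} → x ∈ xs → P x → first P? d xs ≡ first Q? e xs
first-cong P? Q? P⇒Q Q⇒P d e {xs = y ∷ _} x∈ px with P? y | Q? y
... | yes py | yes qy = refl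
... | yes py | no ¬qy = ⊥-elim (¬qy (P⇒Q py))
... | no ¬py | yes qy = ⊥-elim (¬py (Q⇒P qy))
first-cong P? Q? P⇒Q Q⇒P d e (here refl) px | no ¬py | no ¬qy = ⊥-elim (¬py px)
first-cong P? Q? P⇒Q Q⇒P d e (there x∈)  px | no ¬py | no ¬qy = first-cong P? Q? P⇒Q Q⇒P d e x∈ px

module _ {a} {A : Set a} (_≟ᴬ_ : DecidableEquality A) where

  from : A → List A → List A
  from t []       = []
  from t (x ∷ xs) with x ≟ᴬ t
  ... | yes _ = x ∷ xs
  ... | no  _ = from t xs

  from-++ : ∀ t as {bs} → t ∉ as → from t (as ++ t ∷ bs) ≡ t ∷ bs
  from-++ t [] t∉ with t ≟ᴬ t
  ... | yes _ = refl
  ... | no t≢t = ⊥-elim (t≢t refl)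
  from-++ t (x ∷ as) t∉ with x ≟ᴬ t
  ... | yes refl = ⊥-elim (t∉ (here refl))
  ... | no _ = from-++ t as (t∉ ∘ there)

  assign : ∀ {b} {B : Set b} → (A → B) → List A → List B → A → B
  assign d (x ∷ xs) (c ∷ cs) v with x ≟ᴬ v
  ... | yes _ = c
  ... | no  _ = assign d xs cs v
  assign d _ _ v = d v

  assign∈ : ∀ {b} {B : Set b} {d : A → B} (L : A → List B) → (∀ v → d v ∈ L v) → ∀ {xs cs} →
    Pointwise _∈_ cs (map L xs) → ∀ v → assign d xs cs v ∈ L v
  assign∈ L d∈ {[]} [] v = d∈ v
  assign∈ L d∈ {x ∷ xs} (c∈ ∷ cs∈) v with x ≟ᴬ v
  ... | yes refl = c∈
  ... | no _     = assign∈ L d∈ cs∈ v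

  map-assign : ∀ {b} {B : Set b} {d : A → B} (L : A → List B) {xs cs} →
    Pointwise _∈_ cs (map L xs) → Unique xs → map (assign d xs cs) xs ≡ cs
  map-assign L {[]} [] _ = refl
  map-assign {d = d} L {x ∷ xs} {c ∷ cs} (c∈ ∷ cs∈) (x∉ ∷ u) =
    cong₂ _∷_ head≡ (trans (map-cong-local (All.tabulate tail≡)) (map-assign L cs∈ u))
    where
    head≡ : assign d (x ∷ xs) (c ∷ cs) x ≡ c
    head≡ with x ≟ᴬ x
    ... | yes _  = refl
    ... | no x≢x = ⊥-elim (x≢x refl)
    tail≡ : ∀ {y} → y ∈ xs → assign d (x ∷ xs) (c ∷ cs) y ≡ assign d xs cs y
    tail≡ {y} y∈ with x ≟ᴬ y
    ... | yes refl = ⊥-elim (All.lookup x∉ y∈ refl)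
    ... | no _     = refl

Unique⇒length≤∣p∣ : ∀ {n} {p : Subset n} {xs} → Unique xs → All (_∈ˢ p) xs → length xs ≤ ∣ p ∣
Unique⇒length≤∣p∣ [] [] = z≤n
Unique⇒length≤∣p∣ {p = p} (x∉ ∷ u) (x∈ ∷ xs∈) =
  ≤-trans (s≤s (Unique⇒length≤∣p∣ u (All.tabulate λ y∈ →
            Subset.x∈p∧x≢y⇒x∈p-y (All.lookup xs∈ y∈) (All.lookup x∉ y∈ ∘ sym))))
          (Subset.x∈p⇒∣p-x∣<∣p∣ x∈)

++-≡[] : ∀ {a} {A : Set a} (xs ys zs : List A) → xs ++ ys ++ zs ≡ [] → ys ≡ []
++-≡[] [] [] zs eq = refl

map-≡[] : ∀ {a b} {A : Set a} {B : Set b} (f : A → B) xs → map f xs ≡ [] → xs ≡ []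
map-≡[] f [] eq = refl

reverse-≡[] : ∀ {a} {A : Set a} {xs : List A} → reverse xs ≡ [] → xs ≡ []
reverse-≡[] {xs = xs} eq = trans (sym (reverse-involutive xs)) (cong reverse eq)

reverse-++₃ : ∀ {a} {A : Set a} (xs ys zs : List A) → reverse (xs ++ ys ++ zs) ≡ reverse zs ++ reverse ys ++ reverse xs
reverse-++₃ xs ys zs = trans (reverse-++ xs (ys ++ zs))
  (trans (cong (_++ reverse xs) (reverse-++ ys zs)) (++-assoc (reverse zs) (reverse ys) (reverse xs)))

reverse-≡-++₃ : ∀ {a} {A : Set a} (ws xs ys zs : List A) → reverse ws ≡ xs ++ ys ++ zs → ws ≡ reverse zs ++ reverse ys ++ reverse xs
reverse-≡-++₃ ws xs ys zs eq = trans (sym (reverse-involutive ws)) (trans (cong reverse eq) (reverse-++₃ xs ys zs))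

++-assoc₃ : ∀ {a} {A : Set a} (ws xs ys zs : List A) → (ws ++ xs ++ ys) ++ zs ≡ ws ++ xs ++ ys ++ zs
++-assoc₃ ws xs ys zs = trans (++-assoc ws (xs ++ ys) zs) (cong (ws ++_) (++-assoc xs ys zs))

-- One of the three parts has at least a third of the total length.
Near-thirds : ∀ D x y z {ρ} → y ≢ [] → Near D (x ++ y ++ z) ρ →
  (x ≢ [] × Near (3 * suc D) x ρ) ⊎ Near (3 * suc D) y ρ ⊎ (z ≢ [] × Near (3 * suc D) z ρ)
Near-thirds D x y z {ρ} y≢[] (pre , post , eq , le) = cases
  where
  t = length x + (length y + length z)
  len≡ : length (x ++ y ++ z) ≡ t
  len≡ = trans (length-++ x) (cong (length x +_) (length-++ y))
  1≤t : 1 ≤ t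
  1≤t = ≤-trans (1≤length y≢[]) (≤-trans (m≤m+n (length y) (length z)) (m≤n+m _ (length x)))
    where
    1≤length : ∀ {w : List ℕ} → w ≢ [] → 1 ≤ length w
    1≤length {[]}    ne = ⊥-elim (ne refl)
    1≤length {_ ∷ _} ne = s≤s z≤n
  nonempty : ∀ w → t ≤ 3 * length w → w ≢ []
  nonempty .[] h refl with ≤-trans 1≤t h
  ... | ()
  offset : ∀ w {i} → t ≤ 3 * length w → i ≤ t → length pre + i ≤ 3 * suc D * length w
  -- The whole word starts at offset at most `D * t`, the piece at most `t` later, and `t` is at
  -- most `3 * length w`. Hence the factor `3 * suc D`.
  offset w {i} h i≤t = begin
    length pre + i       ≤⟨ +-mono-≤ (subst (λ k → length pre ≤ D * k) len≡ le) i≤t ⟩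
    D * t + t            ≡⟨ +-comm (D * t) t ⟩
    suc D * t            ≤⟨ *-monoʳ-≤ (suc D) h ⟩
    suc D * (3 * length w) ≡⟨ lem D (length w) ⟩
    3 * suc D * length w ∎
    where
    open ≤-Reasoning
    lem : ∀ D k → suc D * (3 * k) ≡ 3 * suc D * k
    lem = solve-∀
  ρ≡ : ρ ≡ pre ++ x ++ y ++ z ++ post
  ρ≡ = trans eq (cong (pre ++_) (++-assoc₃ x y z post))
  cases : _
  cases with t ≤? 3 * length x | t ≤? 3 * length y | t ≤? 3 * length z
  ... | yes h | _ | _ = inj₁ (nonempty x h , pre , y ++ z ++ post , ρ≡ ,
    subst (_≤ _) (+-identityʳ (length pre)) (offset x h z≤n))
  ... | no _ | yes h | _ = inj₂ (inj₁ (pre ++ x , z ++ post , trans ρ≡ (sym (++-assoc pre x _)) ,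
    subst (_≤ _) (sym (length-++ pre)) (offset y h (m≤m+n (length x) _))))
  ... | no _ | no _ | yes h = inj₂ (inj₂ (nonempty z h , pre ++ x ++ y , post , trans ρ≡ (sym (++-assoc₃ pre x y _)) ,
    subst (_≤ _) (sym (trans (length-++ pre) (cong (length pre +_) (length-++ x))))
      (offset z h (+-monoʳ-≤ (length x) (m≤m+n (length y) (length z))))))
  ... | no hx | no hy | no hz = ⊥-elim (<-irrefl (lem (length x) (length y) (length z))
    (+-mono-< (≰⇒> hx) (+-mono-< (≰⇒> hy) (≰⇒> hz))))
    where
    lem : ∀ i j k → 3 * i + (3 * j + 3 * k) ≡ i + (j + k) + (i + (j + k) + (i + (j + k)))
    lem = solve-∀

-- The first summand is the list size needed to colour a spine at offset factor `3 * suc D`. The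
-- second serves the components, which get two more rays and that factor in place of `D`.
bound : ℕ → ℕ → ℕ → ℕ
bound zero    m D = 1
bound (suc w) m D = (2 + 4 * spineConst (3 * suc D) m) + bound w (2 + m) (3 * suc D)

nonempty⇒∃∈ : ∀ {a} {A : Set a} {xs : List A} → 1 ≤ length xs → ∃[ x ] x ∈ xs
nonempty⇒∃∈ {xs = x ∷ _} _ = x , here refl

-- Connectivity inside a vertex set of a tree.

module Tree {n : ℕ} (G : Graph n) (acyclic : ¬ HasCycle G)
            (connected : ∀ u v → ∃[ xs ] Walks.Walk G u xs v × Unique xs) where

  open Walks G
  open Acyclic acyclic

  V : Set
  V = Fin n

  Conn : (V → Set) → V → V → Set
  Conn U u v = ∃[ xs ] Walk u xs v × All U xs

  module _ {U : V → Set} where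

    Conn-sym : ∀ {u v} → Conn U u v → Conn U v u
    Conn-sym (_ , p , us) = _ , reverse-walk p , All-reverse us

    Conn-trans : ∀ {u v w} → Conn U u v → Conn U v w → Conn U u w
    Conn-trans (_ , p , us) (_ , q , vs) with compose p q
    ... | _ , r , sub = _ , r , All.tabulate ([ All.lookup us , All.lookup vs ]′ ∘ sub)

    Conn-on : ∀ {u xs v x} → Walk u xs v → All U xs → x ∈ xs → Conn U u x
    Conn-on p us x∈ with ∈-∃++ x∈
    ... | as , bs , refl = _ , proj₁ (split-at as p) ,
      All.++⁺ (All.++⁻ˡ as us) (All.head (All.++⁻ʳ as us) ∷ [])

    Conn-last : ∀ {u v} → Conn U u v → U v
    Conn-last (_ , p , us) = All.lookup us (last∈ p)

    -- Testing the one path from `u` to `v` is enough, since every walk inside `U` erases to it.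
    Conn? : Decidable U → ∀ u v → Dec (Conn U u v)
    Conn? U? u v with connected u v
    ... | xs , p , uniq = map′ (λ us → xs , p , us) back (All.all? U? xs)
      where
      back : Conn U u v → All U xs
      back (ys , q , vs) with erase q
      ... | zs , r , uniq′ , sub with path-unique p uniq r uniq′
      ... | refl = All.tabulate (All.lookup vs ∘ sub)

  -- Avoiding `R` is the strengthening that carries the induction: a path leaving a component must
  -- not find on the spine a word that it has read inside.
  Good : (V → Set) → List (List ℕ) → ℕ → (V → ℕ) → Set
  Good C R D φ = ∀ {u q v} → Walk u q v → Unique q → All C q →
    (∀ s → map φ q ≢ s ++ s) × (∀ {ρ} → ρ ∈ R → ¬ Near D (map φ q) ρ)

  Orient : List V → List V → Set
  Orient P P′ = P′ ≡ P ⊎ P′ ≡ reverse P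

  -- If `t` comes before `s` on `P`, the walk is reversed, so that `s` always comes first on `P′`.
  between : ∀ {x P y s t} → Walk x P y → s ∈ P → t ∈ P →
    ∃[ P′ ] Orient P P′ × ∃[ a ] ∃[ m ] ∃[ b ] P′ ≡ a ++ m ++ b × Walk s m t
  between {x} {P} {y} {s} {t} p s∈ t∈ with ∈-∃++ s∈
  ... | as , bs , refl = [ case₂ , case₁ ]′ (∈-++⁻ as t∈)
    where
    after : ∀ {y bs} → Walk s (s ∷ bs) y → t ∈ s ∷ bs → ∃₂ λ m b → s ∷ bs ≡ m ++ b × Walk s m t
    after {y} q t∈ with ∈-∃++ t∈
    ... | cs , ds , eq = cs ++ [ t ] , ds , trans eq (sym (++-assoc cs [ t ] ds)) ,
                         proj₁ (split-at cs (subst (λ l → Walk s l y) eq q))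
    rev≡ : reverse (as ++ s ∷ bs) ≡ reverse bs ++ s ∷ reverse as
    rev≡ = trans (reverse-++ as (s ∷ bs)) (trans (cong (_++ reverse as) (unfold-reverse s bs)) (++-assoc (reverse bs) [ s ] (reverse as)))
    case₁ : t ∈ s ∷ bs → _
    case₁ t∈ with after (proj₂ (split-at as p)) t∈
    ... | m , b , eq , q = _ , inj₁ refl , as , m , b , cong (as ++_) eq , q
    case₂ : t ∈ as → _
    case₂ t∈ with after (proj₂ (split-at (reverse bs) (subst (λ l → Walk y l x) rev≡ (reverse-walk p)))) (there (Any.reverse⁺ t∈))
    ... | m , b , eq , q = _ , inj₂ refl , reverse bs , m , b , trans rev≡ (cong (reverse bs ++_) eq) , q

  Orient-Unique : ∀ {P P′} → Orient P P′ → Unique P → Unique P′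
  Orient-Unique (inj₁ refl) u = u
  Orient-Unique (inj₂ refl) u = Unique-reverse u

  Orient-⊆ : ∀ {P P′} → Orient P P′ → P′ ⊆ P
  Orient-⊆ (inj₁ refl) = λ z → z
  Orient-⊆ (inj₂ refl) = Any.reverse⁻

  Orient-reverse : ∀ {P P′} → Orient P P′ → Orient P (reverse P′)
  Orient-reverse (inj₁ refl) = inj₂ refl
  Orient-reverse (inj₂ refl) = inj₁ (reverse-involutive _)

  -- The spine: a path that meets every bag meeting `C`.

  module Spine {w} (pd : PathDecomp G w) {C : V → Set} (C? : Decidable C) where

    open PathDecomp pd

    -- Every edge lies in some bag. At the first edge whose chosen bag is not before `i`, the nearer
    -- endpoint lies in bags on both sides of `i`, hence in `bag i` by `consec`.
    crossing : ∀ {u xs v i₀ i i₁} → Walk u xs v → u ∈ˢ bag i₀ → toℕ i₀ ≤ toℕ i → v ∈ˢ bag i₁ → toℕ i ≤ toℕ i₁ →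
      ∃[ t ] t ∈ xs × t ∈ˢ bag i
    crossing {u} {i₀ = i₀} {i} {i₁} stop u∈ le v∈ le′ = u , here refl , consec u i₀ i i₁ le le′ u∈ v∈
    crossing {u} {i₀ = i₀} {i} (step {v = v} a p) u∈ le v∈ le′ with edges u v a
    ... | j , u∈j , v∈j with ≤-total (toℕ j) (toℕ i)
    ... | inj₂ i≤j = u , here refl , consec u i₀ i j le i≤j u∈ u∈j
    ... | inj₁ j≤i with crossing p v∈j j≤i v∈ le′
    ... | t , t∈ , t∈i = t , there t∈ , t∈i

    spine : (∀ {u v} → C u → C v → Conn C u v) → ∀ {r} → C r →
      ∃[ x ] ∃[ P ] ∃[ y ] Walk x P y × Unique P × All C P ×
        (∀ i v → v ∈ˢ bag i → C v → ∃[ t ] t ∈ P × t ∈ˢ bag i)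
    spine conn {r} r∈C with cover r
    -- The least index gives the first bag that meets `C`; the least `len ∸ toℕ j` gives the last
    -- one.
    ... | i , r∈i with argmin Meets? toℕ i (r , r∈i , r∈C) (allFin len)
                     | argmin Meets? (λ j → len ∸ toℕ j) i (r , r∈i , r∈C) (allFin len)
      where
      Meets? : Decidable (λ i → ∃[ v ] v ∈ˢ bag i × C v)
      Meets? i = Fin.any? λ v → (v Subset.∈? bag i) ×-dec C? v
    ... | i₀ , (x , x∈i₀ , x∈C) , _ , i₀≤ | i₁ , (y , y∈i₁ , y∈C) , _ , i₁≥ with conn x∈C y∈C
    ... | _ , p , cs with erase p
    ... | P , q , uniq , sub = x , P , y , q , uniq , All.tabulate (All.lookup cs ∘ sub) ,
      λ i v v∈i v∈C → crossing q x∈i₀ (All.lookup i₀≤ (∈-allFin i) (v , v∈i , v∈C))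
        y∈i₁ (∸-cancelʳ-≤ (<⇒≤ (Fin.toℕ<n i)) (All.lookup i₁≥ (∈-allFin i) (v , v∈i , v∈C)))

  -- The components left after removing the spine, and how paths pass through them.

  module Components {C : V → Set} (C? : Decidable C) {x y P} (P-walk : Walk x P y) (P-unique : Unique P) where

    U : V → Set
    U v = C v × v ∉ P

    U? : Decidable U
    U? v = C? v ×-dec ¬? (v ∈? P)

    -- The component of `r` in `C` without `P`. It is empty for `r` outside `U`, so that `K r` makes
    -- sense for every vertex.
    K : V → V → Set
    K = Conn U

    K? : ∀ r v → Dec (K r v)
    K? = Conn? U?

    -- A representative of the component of v, so that the colouring chosen for a component does not
    -- depend on the vertex from which it is reached.
    rep : V → V
    rep v = first (λ r → K? r v) v (allFin n)

    rep-cong : ∀ {u v} → Conn U u v → rep v ≡ rep u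
    rep-cong {u} {v} c = first-cong (λ r → K? r v) (λ r → K? r u)
      (λ d → Conn-trans d (Conn-sym c)) (λ d → Conn-trans d c) v u (∈-allFin u) c

    rep-Conn : ∀ {u v} → Conn U u v → K (rep u) v
    rep-Conn {u} c =
      Conn-trans (first-sat (λ r → K? r u) u (∈-allFin u) (Conn-trans c (Conn-sym c))) c

    Attached : V → V → Set
    Attached r t = t ∈ P × ∃[ k ] K r k × Adj G k t

    Attached? : ∀ r t → Dec (Attached r t)
    Attached? r t = (t ∈? P) ×-dec Fin.any? λ k → K? r k ×-dec T? (adj G k t)

    attachment : V → V
    attachment r = first (Attached? r) r (allFin n)

    -- Otherwise `s` and `t` would be joined both along `P` and through the component, which avoids
    -- `P`; paths in a tree are unique.
    Attached-unique : ∀ {r s t} → Attached r s → Attached r t → s ≡ t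
    Attached-unique {r} {s} {t} (s∈P , k , rk , ks) (t∈P , l , rl , lt) with s Fin.≟ t
    ... | yes s≡t = s≡t
    ... | no  s≢t with Conn-trans (Conn-sym rk) rl
    ... | _ , p , us with erase p
    ... | xs , q , uniq , sub with between P-walk s∈P t∈P
    ... | P′ , o , a , m , b , refl , p′ = ⊥-elim (∉P (first∈ q) (Orient-⊆ o (∈-++⁺ʳ a (∈-++⁺ˡ k∈m))))
      where
      ∉P : ∀ {z} → z ∈ xs → z ∉ P
      ∉P z∈ = proj₂ (All.lookup us (sub z∈))
      detour : Walk s (s ∷ xs ++ [ t ]) t
      detour = step (Graph.sym G k s ks) (link q lt stop)
      detour-unique : Unique (s ∷ xs ++ [ t ])
      detour-unique = All.++⁺ (All.tabulate λ { z∈ refl → ∉P z∈ s∈P }) (s≢t ∷ [])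
                    ∷ Uniq.++⁺ uniq ([] ∷ []) λ { (z∈ , here refl) → ∉P z∈ t∈P }
      k∈m : k ∈ m
      k∈m = subst (k ∈_) (path-unique detour detour-unique p′ (Unique-infix a m (Orient-Unique o P-unique)))
                  (there (∈-++⁺ˡ (first∈ q)))

    attachment≡ : ∀ {r t} → Attached r t → attachment r ≡ t
    attachment≡ {r} {t} at = Attached-unique (first-sat (Attached? r) r (∈-allFin t) at) at

    record Split (u : V) (q : List V) (v : V) : Set where
      field
        {l m r P′ a b} : List V
        {s t}          : V
        q≡        : q ≡ l ++ m ++ r
        l⊆U       : All U l
        r⊆U       : All U r
        orient    : Orient P P′
        P′≡       : P′ ≡ a ++ m ++ b
        middle    : Walk s m t
        left      : l ≡ [] ⊎ ∃[ k ] Walk u l k × Adj G k s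
        right     : r ≡ [] ⊎ ∃[ k ] Adj G t k × Walk k r v

    -- The path is cut at its first and its last vertex on `P`. Between them it is the unique path
    -- of the tree, so it follows `P`.
    split-walk : ∀ {u q v} → Walk u q v → Unique q → All C q → All U q ⊎ Split u q v
    split-walk {u} {q} {v} p uniq cs with split-first (_∈? P) q
    ... | inj₁ none = inj₁ (All.zip (cs , none))
    ... | inj₂ (l , s , q′ , refl , l∉ , s∈P) with split-last (_∈? P) (s ∷ q′)
    ... | inj₁ (s∉P ∷ _) = ⊥-elim (s∉P s∈P)
    ... | inj₂ (m₀ , t , r , eq , t∈P , r∉) with between P-walk s∈P t∈P
    ... | P′ , o , a , m , b , refl , p′ = inj₂ record
      { l = l ; m = m ; r = r ; a = a ; b = b ; s = s ; t = t
      ; q≡ = cong (l ++_) tail≡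
      ; l⊆U = All.zip (All.++⁻ˡ l cs , l∉)
      ; r⊆U = All.zip (All.++⁻ʳ m (subst (All C) tail≡ (All.++⁻ʳ l cs)) , r∉)
      ; orient = o ; P′≡ = refl ; middle = p′
      ; left = left-leg l p
      ; right = right-leg (proj₂ (split-at m₀ tail-walk))
      }
      where
      tail-walk : Walk s (m₀ ++ t ∷ r) v
      tail-walk = subst (λ z → Walk s z v) eq (proj₂ (split-at l p))
      tail-unique : Unique (m₀ ++ t ∷ r)
      tail-unique = subst Unique eq (proj₁ (proj₂ (Unique-++⁻ l uniq)))
      m≡ : m₀ ++ [ t ] ≡ m
      m≡ = path-unique (proj₁ (split-at m₀ tail-walk))
             (proj₁ (Unique-++⁻ (m₀ ++ [ t ]) (subst Unique (sym (++-assoc m₀ [ t ] r)) tail-unique)))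
             p′ (Unique-infix a m (Orient-Unique o P-unique))
      tail≡ : s ∷ q′ ≡ m ++ r
      tail≡ = trans eq (trans (sym (++-assoc m₀ [ t ] r)) (cong (_++ r) m≡))

    -- Gluing the colourings of the spine and of the components.

    module Combine (D : ℕ) (R : List (List ℕ)) (φP : V → ℕ)
      (spine-far : ∀ a m b {ρ} → P ≡ a ++ m ++ b → m ≢ [] → ρ ∈ R →
        ¬ (Near (3 * suc D) (map φP m) ρ ⊎ Near (3 * suc D) (reverse (map φP m)) ρ))
      (spine-sparse : ∀ pre z y rest → map φP P ≡ pre ++ z ++ y ++ z ++ rest → z ≢ [] →
        ¬ length y ≤ 3 * suc D * length z)
      where

      D⁺ : ℕ
      D⁺ = 3 * suc D

      rays : V → List (List ℕ)
      rays r = map φP (from Fin._≟_ (attachment r) P) ∷ map φP (from Fin._≟_ (attachment r) (reverse P)) ∷ R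

      spine-far′ : ∀ {P′} a m b {ρ} → Orient P P′ → P′ ≡ a ++ m ++ b → m ≢ [] → ρ ∈ R → ¬ Near D⁺ (map φP m) ρ
      spine-far′ a m b (inj₁ refl) eq m≢[] ρ∈ near = spine-far a m b eq m≢[] ρ∈ (inj₁ near)
      spine-far′ a m b {ρ} (inj₂ refl) eq m≢[] ρ∈ near =
        spine-far (reverse b) (reverse m) (reverse a) (reverse-≡-++₃ P a m b eq) (m≢[] ∘ reverse-≡[]) ρ∈
          (inj₂ (subst (λ z → Near D⁺ z ρ) (sym m≡) near))
        where
        m≡ : reverse (map φP (reverse m)) ≡ map φP m
        m≡ = trans (sym (reverse-map φP (reverse m))) (cong (map φP) (reverse-involutive m))

      spine-sparse′ : ∀ {P′} → Orient P P′ → ∀ pre z y rest → map φP P′ ≡ pre ++ z ++ y ++ z ++ rest → z ≢ [] →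
        ¬ length y ≤ D⁺ * length z
      spine-sparse′ (inj₁ refl) = spine-sparse
      spine-sparse′ (inj₂ refl) pre z y rest eq z≢[] le =
        spine-sparse (reverse rest) (reverse z) (reverse y) (reverse pre) eq′ (z≢[] ∘ reverse-≡[])
          (subst₂ (λ i j → i ≤ D⁺ * j) (sym (length-reverse y)) (sym (length-reverse z)) le)
        where
        open ≡-Reasoning
        eq′ : map φP P ≡ reverse rest ++ reverse z ++ reverse y ++ reverse z ++ reverse pre
        eq′ = begin
          map φP P ≡⟨ reverse-≡-++₃ (map φP P) pre z (y ++ z ++ rest) (trans (sym (reverse-map φP P)) eq) ⟩
          reverse (y ++ z ++ rest) ++ reverse z ++ reverse pre
            ≡⟨ cong (_++ reverse z ++ reverse pre) (reverse-++₃ y z rest) ⟩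
          (reverse rest ++ reverse z ++ reverse y) ++ reverse z ++ reverse pre
            ≡⟨ ++-assoc (reverse rest) (reverse z ++ reverse y) (reverse z ++ reverse pre) ⟩
          reverse rest ++ (reverse z ++ reverse y) ++ reverse z ++ reverse pre
            ≡⟨ cong (reverse rest ++_) (++-assoc (reverse z) (reverse y) (reverse z ++ reverse pre)) ⟩
          reverse rest ++ reverse z ++ reverse y ++ reverse z ++ reverse pre ∎

      ray∈ : ∀ {P′ r s a b} → Orient P P′ → P′ ≡ a ++ s ∷ b → attachment r ≡ s → map φP (s ∷ b) ∈ rays r
      ray∈ {P′} {r} {s} {a} {b} o P′≡ at = [ (λ eq → here (ray≡ eq)) , (λ eq → there (here (ray≡ eq))) ]′ o
        where
        s∉a : s ∉ a
        s∉a s∈ = proj₂ (proj₂ (Unique-++⁻ a (subst Unique P′≡ (Orient-Unique o P-unique)))) s∈ (here refl)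
        from≡ : from Fin._≟_ (attachment r) P′ ≡ s ∷ b
        from≡ = trans (cong₂ (from Fin._≟_) at P′≡) (from-++ Fin._≟_ s a s∉a)
        ray≡ : ∀ {P″} → P′ ≡ P″ → map φP (s ∷ b) ≡ map φP (from Fin._≟_ (attachment r) P″)
        ray≡ eq = cong (map φP) (trans (sym from≡) (cong (from Fin._≟_ (attachment r)) eq))

      module _ (ψ : V → V → ℕ)
        (ψ-good : ∀ r → Good (K r) (rays r) D⁺ (ψ r))
        where

        φ : V → ℕ
        φ v with v ∈? P
        ... | yes _ = φP v
        ... | no  _ = ψ (rep v) v

        map-φ-spine : ∀ {m} → m ⊆ P → map φ m ≡ map φP m
        map-φ-spine {m} m⊆P = map-cong-local (All.tabulate lem)
          where
          lem : ∀ {v} → v ∈ m → φ v ≡ φP v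
          lem {v} v∈ with v ∈? P
          ... | yes _  = refl
          ... | no v∉P = ⊥-elim (v∉P (m⊆P v∈))

        leg-K : ∀ {u q v} → Walk u q v → All U q → All (K (rep u)) q
        leg-K p us = All.tabulate λ z∈ → rep-Conn (Conn-on p us z∈)

        map-φ-leg : ∀ {u q v} → Walk u q v → All U q → ∀ {q′} → q′ ⊆ q → map φ q′ ≡ map (ψ (rep u)) q′
        map-φ-leg {u} {q} p us {q′} sub = map-cong-local (All.tabulate lem)
          where
          lem : ∀ {z} → z ∈ q′ → φ z ≡ ψ (rep u) z
          lem {z} z∈ with z ∈? P
          ... | yes z∈P = ⊥-elim (proj₂ (All.lookup us (sub z∈)) z∈P)
          ... | no  _   = cong (λ r → ψ r z) (rep-cong (Conn-on p us (sub z∈)))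

        -- A factor of the word of a leg is the word of a path in the same component, and so is its
        -- reversal; `ψ-good` applies to both.
        leg-far : ∀ {u q v} → Walk u q v → Unique q → All U q → ∀ w₁ z w₂ → map φ q ≡ w₁ ++ z ++ w₂ → z ≢ [] →
          ∀ {ρ} → ρ ∈ rays (rep u) → ¬ Near D⁺ z ρ × ¬ Near D⁺ (reverse z) ρ
        leg-far {u} {q} p uniq us w₁ z w₂ eq z≢[] {ρ} ρ∈ with map-++⁻ φ q w₁ eq
        ... | q₁ , q′ , refl , refl , eq′ with map-++⁻ φ q′ z eq′
        ... | q₂ , q₃ , refl , refl , refl with infix-walk q₁ q₂ p (λ { refl → z≢[] refl })
        ... | s , t , p₂ =
          (λ near → proj₂ (ψ-good (rep u) p₂ uniq₂ K₂) ρ∈ (subst (λ w → Near D⁺ w ρ) word≡ near)) ,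
          (λ near → proj₂ (ψ-good (rep u) (reverse-walk p₂) (Unique-reverse uniq₂) (All-reverse K₂)) ρ∈
                      (subst (λ w → Near D⁺ w ρ) (trans (cong reverse word≡) (sym (reverse-map (ψ (rep u)) q₂))) near))
          where
          uniq₂ : Unique q₂
          uniq₂ = Unique-infix q₁ q₂ uniq
          K₂ : All (K (rep u)) q₂
          K₂ = All.++⁻ˡ q₂ (All.++⁻ʳ q₁ (leg-K p us))
          word≡ : map φ q₂ ≡ map (ψ (rep u)) q₂
          word≡ = map-φ-leg p us (λ z∈ → ∈-++⁺ʳ q₁ (∈-++⁺ˡ z∈))

        module _ {u q v} (uniq : Unique q) (sp : Split u q v) where

          open Split sp

          uniq′ : Unique (l ++ m ++ r)
          uniq′ = subst Unique q≡ uniq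

          m⊆P : m ⊆ P
          m⊆P z∈ = Orient-⊆ orient (subst (_ ∈_) (sym P′≡) (∈-++⁺ʳ a (∈-++⁺ˡ z∈)))

          mid≡ : map φ m ≡ map φP m
          mid≡ = map-φ-spine m⊆P

          m≢[] : m ≢ []
          m≢[] eq with subst (s ∈_) eq (first∈ middle)
          ... | ()

          word : map φ q ≡ map φ l ++ map φ m ++ map φ r
          word = trans (cong (map φ) q≡) (trans (map-++ φ l (m ++ r)) (cong (map φ l ++_) (map-++ φ m r)))

          -- The left leg hangs at `s`, and `m ++ b` is the spine from `s` onwards, so its colour
          -- word is one of the rays of that component.
          left-far : ∀ w₁ z w₂ → map φ l ≡ w₁ ++ z ++ w₂ → z ≢ [] →
            (∀ {ρ} → ρ ∈ R → ¬ Near D⁺ z ρ) × ¬ Near D⁺ z (map φP (m ++ b))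
          left-far w₁ z w₂ eq z≢[] with left
          ... | inj₁ refl = ⊥-elim (z≢[] (++-≡[] w₁ z w₂ (sym eq)))
          ... | inj₂ (k , p , ks) = (λ ρ∈ → proj₁ (far (there (there ρ∈)))) , proj₁ (far ray)
            where
            far : ∀ {ρ} → ρ ∈ rays (rep u) → _
            far = leg-far p (proj₁ (Unique-++⁻ l uniq′)) l⊆U w₁ z w₂ eq z≢[]
            s-attached : Attached (rep u) s
            s-attached = m⊆P (first∈ middle) , k , All.lookup (leg-K p l⊆U) (last∈ p) , ks
            ray : map φP (m ++ b) ∈ rays (rep u)
            ray with m | first-cons middle | P′≡
            ... | _ | m′ , refl | P′≡ = ray∈ orient P′≡ (attachment≡ s-attached)

          -- The right leg hangs at `t`, from where the middle part is read backwards; hence the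
          -- reversals.
          right-far : ∀ w₁ z w₂ → map φ r ≡ w₁ ++ z ++ w₂ → z ≢ [] →
            (∀ {ρ} → ρ ∈ R → ¬ Near D⁺ z ρ) × ¬ Near D⁺ (reverse z) (map φP (reverse m ++ reverse a))
          right-far w₁ z w₂ eq z≢[] with right
          ... | inj₁ refl = ⊥-elim (z≢[] (++-≡[] w₁ z w₂ (sym eq)))
          ... | inj₂ (k , tk , p) = (λ ρ∈ → proj₁ (far (there (there ρ∈)))) , proj₂ (far ray)
            where
            far : ∀ {ρ} → ρ ∈ rays (rep k) → _
            far = leg-far p (proj₁ (proj₂ (Unique-++⁻ m (proj₁ (proj₂ (Unique-++⁻ l uniq′)))))) r⊆U w₁ z w₂ eq z≢[]
            t-attached : Attached (rep k) t
            t-attached = m⊆P (last∈ middle) , k , All.lookup (leg-K p r⊆U) (first∈ p) , Graph.sym G t k tk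
            ray : map φP (reverse m ++ reverse a) ∈ rays (rep k)
            ray with reverse m | first-cons (reverse-walk middle) | trans (cong reverse P′≡) (reverse-++₃ a m b)
            ... | _ | m′ , refl | eq′ = ray∈ (Orient-reverse orient) eq′ (attachment≡ t-attached)

          2≤D⁺ : 2 ≤ D⁺
          2≤D⁺ = ≤-trans (n≤1+n 2) (*-monoʳ-≤ 3 (s≤s z≤n))

          split-squarefree : ∀ w → map φ q ≢ w ++ w
          split-squarefree w eq =
            ++-squarefree (map φ l) (map φ m) (map φ r) w (m≢[] ∘ map-≡[] φ m) left-ok right-ok mid-ok (trans (sym word) eq)
            where
            left-ok : ∀ b₁ z b₂ a₁ a₂ → map φ m ≡ b₁ ++ z ++ b₂ → map φ l ≡ a₁ ++ z ++ a₂ → z ≢ [] → ¬ length b₁ ≤ 2 * length z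
            left-ok b₁ z b₂ a₁ a₂ m≡ l≡ z≢[] le = proj₂ (left-far a₁ z a₂ l≡ z≢[])
              (Near-mono {x = z} 2≤D⁺ (b₁ , b₂ ++ map φP b , eq′ , le))
              where
              eq′ : map φP (m ++ b) ≡ b₁ ++ z ++ b₂ ++ map φP b
              eq′ = trans (map-++ φP m b) (trans (cong (_++ map φP b) (trans (sym mid≡) m≡)) (++-assoc₃ b₁ z b₂ (map φP b)))
            right-ok : ∀ b₁ z b₂ e₁ e₂ → map φ m ≡ b₁ ++ z ++ b₂ → map φ r ≡ e₁ ++ z ++ e₂ → z ≢ [] → ¬ length b₂ ≤ 2 * length z
            right-ok b₁ z b₂ e₁ e₂ m≡ r≡ z≢[] le = proj₂ (right-far e₁ z e₂ r≡ z≢[])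
              (Near-mono {x = reverse z} 2≤D⁺ (reverse b₂ , reverse b₁ ++ map φP (reverse a) , eq′ ,
                subst₂ (λ i j → i ≤ 2 * j) (sym (length-reverse b₂)) (sym (length-reverse z)) le))
              where
              eq′ : map φP (reverse m ++ reverse a) ≡ reverse b₂ ++ reverse z ++ reverse b₁ ++ map φP (reverse a)
              eq′ = trans (map-++ φP (reverse m) (reverse a))
                      (trans (cong (_++ map φP (reverse a))
                               (trans (reverse-map φP m) (trans (cong reverse (trans (sym mid≡) m≡)) (reverse-++₃ b₁ z b₂))))
                             (++-assoc₃ (reverse b₂) (reverse z) (reverse b₁) (map φP (reverse a))))
            mid-ok : ∀ b₁ z y b₂ → map φ m ≡ b₁ ++ z ++ y ++ z ++ b₂ → z ≢ [] → ¬ length y ≤ 2 * length z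
            mid-ok b₁ z y b₂ m≡ z≢[] le = spine-sparse′ orient (map φP a ++ b₁) z y (b₂ ++ map φP b) eq′ z≢[]
              (≤-trans le (*-monoˡ-≤ (length z) 2≤D⁺))
              where
              open ≡-Reasoning
              eq′ : map φP P′ ≡ (map φP a ++ b₁) ++ z ++ y ++ z ++ b₂ ++ map φP b
              eq′ = begin
                map φP P′ ≡⟨ cong (map φP) P′≡ ⟩
                map φP (a ++ m ++ b) ≡⟨ trans (map-++ φP a (m ++ b)) (cong (map φP a ++_) (map-++ φP m b)) ⟩
                map φP a ++ map φP m ++ map φP b ≡⟨ cong (λ k → map φP a ++ k ++ map φP b) (trans (sym mid≡) m≡) ⟩
                map φP a ++ (b₁ ++ z ++ y ++ z ++ b₂) ++ map φP b
                  ≡⟨ cong (map φP a ++_) (++-assoc₃ b₁ z (y ++ z ++ b₂) (map φP b)) ⟩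
                map φP a ++ b₁ ++ z ++ (y ++ z ++ b₂) ++ map φP b
                  ≡⟨ cong (λ k → map φP a ++ b₁ ++ z ++ k) (++-assoc₃ y z b₂ (map φP b)) ⟩
                map φP a ++ b₁ ++ z ++ y ++ z ++ b₂ ++ map φP b ≡⟨ sym (++-assoc (map φP a) b₁ _) ⟩
                (map φP a ++ b₁) ++ z ++ y ++ z ++ b₂ ++ map φP b ∎

          -- `Near-thirds` would put one of the three parts near `ρ` at factor `D⁺`. The legs avoid
          -- this because `R` is among their rays, the middle by the choice of the spine word.
          split-far : ∀ {ρ} → ρ ∈ R → ¬ Near D (map φ q) ρ
          split-far {ρ} ρ∈ near with Near-thirds D (map φ l) (map φ m) (map φ r) (m≢[] ∘ map-≡[] φ m) (subst (λ k → Near D k ρ) word near)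
          ... | inj₁ (ne , nr) = proj₁ (left-far [] (map φ l) [] (sym (++-identityʳ _)) ne) ρ∈ nr
          ... | inj₂ (inj₁ nr) = spine-far′ a m b orient P′≡ m≢[] ρ∈ (subst (λ k → Near D⁺ k ρ) mid≡ nr)
          ... | inj₂ (inj₂ (ne , nr)) = proj₁ (right-far [] (map φ r) [] (sym (++-identityʳ _)) ne) ρ∈ nr

        φ-good : Good C R D φ
        φ-good {u} {q} p uniq cs with split-walk p uniq cs
        ... | inj₂ sp = split-squarefree uniq sp , split-far uniq sp
        ... | inj₁ us =
          (λ s eq → proj₁ good s (trans (sym word≡) eq)) ,
          (λ {ρ} ρ∈ near → proj₂ good (there (there ρ∈)) (subst (λ k → Near D⁺ k ρ) word≡ (Near-mono {x = map φ q} D≤D⁺ near)))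
          where
          good = ψ-good (rep u) p uniq (leg-K p us)
          word≡ : map φ q ≡ map (ψ (rep u)) q
          word≡ = map-φ-leg p us (λ z → z)
          D≤D⁺ : D ≤ D⁺
          D≤D⁺ = ≤-trans (n≤1+n D) (m≤n*m (suc D) 3)

        combine : (L : V → List ℕ) → (∀ v → φP v ∈ L v) → (∀ r v → ψ r v ∈ L v) →
          ∃[ φ ] (∀ v → φ v ∈ L v) × Good C R D φ
        combine L φP∈ ψ∈ = φ , φ∈ , φ-good
          where
          φ∈ : ∀ v → φ v ∈ L v
          φ∈ v with v ∈? P
          ... | yes _ = φP∈ v
          ... | no  _ = ψ∈ (rep v) v

  -- Induction on the width.

  module _ {w₀} (pd : PathDecomp G w₀) where

    open PathDecomp pd

    -- As `C` is a predicate, the size of its intersection with a bag is measured by duplicate-free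
    -- lists.
    Colourable : ℕ → ℕ → ℕ → ℕ → Set₁
    Colourable w m D ℓ = {C : V → Set} → Decidable C → (∀ {u v} → C u → C v → Conn C u v) →
      (∀ i xs → Unique xs → All (λ v → v ∈ˢ bag i × C v) xs → length xs ≤ w) →
      ∀ R → length R ≤ m → (L : V → List ℕ) → (∀ v → Unique (L v)) → (∀ v → ℓ ≤ length (L v)) →
      ∃[ φ ] (∀ v → φ v ∈ L v) × Good C R D φ

    -- Every vertex lies in a bag, so width 0 leaves no vertex in `C`, and any choice from the lists
    -- will do.
    colourable-empty : ∀ {m D} → Colourable 0 m D 1
    colourable-empty {C = C} C? conn thin R R≤ L L-unique L≥ =
      proj₁ ∘ some , proj₂ ∘ some , λ p _ cs → ⊥-elim (empty (All.lookup cs (first∈ p)))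
      where
      some : ∀ v → ∃[ c ] c ∈ L v
      some v = nonempty⇒∃∈ (L≥ v)
      empty : ∀ {v} → ¬ C v
      empty {v} v∈C with cover v
      ... | i , v∈i with thin i (v ∷ []) ([] ∷ []) ((v∈i , v∈C) ∷ [])
      ... | ()

    colourable-suc : ∀ {w m D ℓ} → Colourable w (2 + m) (3 * suc D) ℓ →
      Colourable (suc w) m D (2 + 4 * spineConst (3 * suc D) m + ℓ)
    colourable-suc {w} {m} {D} {ℓ} colour {C} C? conn thin R R≤ L L-unique L≥ with Fin.any? C?
    ... | no none = proj₁ ∘ some , proj₂ ∘ some , λ p _ cs → ⊥-elim (none (_ , All.lookup cs (first∈ p)))
      where
      some : ∀ v → ∃[ c ] c ∈ L v
      some v = nonempty⇒∃∈ (≤-trans (s≤s z≤n) (L≥ v))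
    ... | yes (_ , r∈C) = along (Spine.spine pd C? conn r∈C)
      where
      some : ∀ v → ∃[ c ] c ∈ L v
      some v = nonempty⇒∃∈ (≤-trans (s≤s z≤n) (L≥ v))

      along : (∃[ x ] ∃[ P ] ∃[ y ] Walk x P y × Unique P × All C P ×
                (∀ i v → v ∈ˢ bag i → C v → ∃[ t ] t ∈ P × t ∈ˢ bag i)) →
              ∃[ φ ] (∀ v → φ v ∈ L v) × Good C R D φ
      along (x , P , y , P-walk , P-unique , P⊆C , P-meets) =
        combine ψ ψ-good L (assign∈ Fin._≟_ L (proj₂ ∘ some) word∈) (λ r → proj₁ (proj₂ (component r)))
        where
        open Components C? P-walk P-unique

        spine-colours : ∃[ u ] Pointwise _∈_ u (map L P) ×
          (∀ pre x rest z → u ≡ pre ++ x ++ rest → x ≢ [] → z ∈ rest ∷ R →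
            ¬ (Near (3 * suc D) x z ⊎ Near (3 * suc D) (reverse x) z))
        spine-colours = spine-word (3 * suc D) R R≤ (map L P) (All.map⁺ (All.universal L-unique P))
          (All.map⁺ (All.universal (λ v → ≤-trans (m≤m+n _ ℓ) (L≥ v)) P))

        word∈ : Pointwise _∈_ (proj₁ spine-colours) (map L P)
        word∈ = proj₁ (proj₂ spine-colours)

        φP : V → ℕ
        φP = assign Fin._≟_ (proj₁ ∘ some) P (proj₁ spine-colours)

        φP-word : map φP P ≡ proj₁ spine-colours
        φP-word = map-assign Fin._≟_ L word∈ P-unique

        spine-far : ∀ a m b {ρ} → P ≡ a ++ m ++ b → m ≢ [] → ρ ∈ R →
          ¬ (Near (3 * suc D) (map φP m) ρ ⊎ Near (3 * suc D) (reverse (map φP m)) ρ)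
        spine-far a m b P≡ m≢[] ρ∈ = proj₂ (proj₂ spine-colours) (map φP a) (map φP m) (map φP b) _
          (trans (sym φP-word) (trans (cong (map φP) P≡)
            (trans (map-++ φP a (m ++ b)) (cong (map φP a ++_) (map-++ φP m b)))))
          (m≢[] ∘ map-≡[] φP m) (there ρ∈)

        spine-sparse : ∀ pre z y rest → map φP P ≡ pre ++ z ++ y ++ z ++ rest → z ≢ [] →
          ¬ length y ≤ 3 * suc D * length z
        spine-sparse pre z y rest eq z≢[] le =
          -- Everything after the first `z` acts as a ray, in which `z` occurs at offset `length y`.
          proj₂ (proj₂ spine-colours) pre z (y ++ z ++ rest) (y ++ z ++ rest)
            (trans (sym φP-word) eq) z≢[] (here refl) (inj₁ (y , rest , refl , le))

        open Combine D R φP spine-far spine-sparse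

        K-connected : ∀ r {u v} → K r u → K r v → Conn (K r) u v
        K-connected r ru rv = Conn-trans (Conn-sym (within ru)) (within rv)
          where
          within : ∀ {v} → K r v → Conn (K r) r v
          within (xs , p , us) = xs , p , All.tabulate (Conn-on p us)

        -- A bag that meets the component also contains a vertex of `P`. That vertex is in `C` but
        -- not in the component, so the count drops by one.
        K-thin : ∀ r i xs → Unique xs → All (λ v → v ∈ˢ bag i × K r v) xs → length xs ≤ w
        K-thin r i []       _    _   = z≤n
        K-thin r i (v ∷ xs) uniq all@((v∈i , rv) ∷ _) with P-meets i v v∈i (proj₁ (Conn-last rv))
        ... | t , t∈P , t∈i = s≤s⁻¹ (thin i (t ∷ v ∷ xs)
          (All.map (λ { (_ , rz) refl → proj₂ (Conn-last rz) t∈P }) all ∷ uniq)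
          ((t∈i , All.lookup P⊆C t∈P) ∷ All.map (λ { (z∈i , rz) → z∈i , proj₁ (Conn-last rz) }) all))

        component : ∀ r → ∃[ ψ ] (∀ v → ψ v ∈ L v) × Good (K r) (rays r) (3 * suc D) ψ
        component r = colour (K? r) (K-connected r) (K-thin r) (rays r) (s≤s (s≤s R≤)) L L-unique
          (λ v → ≤-trans (m≤n+m ℓ _) (L≥ v))

        ψ : V → V → ℕ
        ψ r = proj₁ (component r)

        ψ-good : ∀ r → Good (K r) (rays r) (3 * suc D) (ψ r)
        ψ-good r = proj₂ (proj₂ (component r))

    colourable : ∀ w m D → Colourable w m D (bound w m D)
    colourable zero    m D = colourable-empty {m} {D}
    colourable (suc w) m D = colourable-suc {m = m} {D} (colourable w (2 + m) (3 * suc D))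

-- Passing from words of walks to the graph notions, and the theorem.

++-tabulate : ∀ {a} {A : Set a} r {k} (f : Fin (r + k) → A) →
  tabulate f ≡ tabulate (f ∘ (_↑ˡ k)) ++ tabulate (f ∘ (r ↑ʳ_))
++-tabulate zero    f = refl
++-tabulate (suc r) f = cong (f zero ∷_) (++-tabulate r (f ∘ suc))

module _ {n} (G : Graph n) where

  open Walks G

  squarefree⇒Nonrepetitive : ∀ {φ} → (∀ {u q v} → Walk u q v → Unique q → ∀ s → map φ q ≢ s ++ s) → Nonrepetitive G φ
  squarefree⇒Nonrepetitive {φ} squarefree (suc r) _ p (inj , adjacent) rep =
    squarefree (tabulate-walk p adjacent) (Uniq.tabulate⁺ inj) half
      (trans (map-tabulate p φ) (trans (++-tabulate (suc r) (φ ∘ p)) (cong (half ++_) (sym (tabulate-cong rep)))))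
    where
    half : List ℕ
    half = tabulate {n = suc r} λ i → φ (p (i ↑ˡ suc r))

  Connected⇒path : Connected G → ∀ u v → ∃[ xs ] Walk u xs v × Unique xs
  Connected⇒path conn u v with conn u v
  ... | m , p , (inj , adjacent) , j , j≡ , refl , refl =
    tabulate p ,
    subst (Walk (p zero) (tabulate p) ∘ p) (Fin.toℕ-injective (trans (Fin.toℕ-fromℕ m) (sym j≡))) (tabulate-walk p adjacent) ,
    Uniq.tabulate⁺ inj

theorem2 : Σ (ℕ → ℕ) λ b → ∀ (n : ℕ) (T : Graph n) (k : ℕ) →
    IsTree T → Pathwidth T k → ThueChoosable T (b k)
theorem2 = (λ k → bound (suc k) 0 0) , λ n T k (_ , conn , acyclic) (pd , _) L L-unique L≥ →
  let path = Connected⇒path T conn in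
  Product.map₂ (Product.map₂ λ good → squarefree⇒Nonrepetitive T λ p uniq →
      proj₁ (good p uniq (All.universal (λ _ → tt) _)))
    -- The induction starts with the whole tree as `C` and no rays; bags have at most `k + 1`
    -- vertices, hence the width `suc k`.
    (Tree.colourable T acyclic path pd (suc k) 0 0 {λ _ → ⊤} (λ _ → yes tt)
      (λ {u} {v} _ _ → proj₁ (path u v) , proj₁ (proj₂ (path u v)) , All.universal (λ _ → tt) _)
      (λ i xs uniq all → ≤-trans (Unique⇒length≤∣p∣ uniq (All.map proj₁ all)) (PathDecomp.small pd i))
      [] z≤n L L-unique L≥)
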